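{- Let $G$ be a finite bipartite graph with parts $L\sqcup R$, left-regular of degree $d\ge 2$, and let $n=|L|$, $m=|R|$ with $n\ge m$. Then $\alpha_G(2)\le d-\frac12$. Furthermore, if $\alpha_G(2)=d-\frac12$, then for every integer $t$ with $1\le t\le d$ we have $$\alpha_G(t)\le (d-1)+\frac1t .$$
   Context: Graphs are finite and simple, with nonempty parts. A bipartite graph $G$ with parts $L\sqcup R$ (left part $L$, right part $R$) is left-regular of degree $d$ if every vertex of $L$ has exactly $d$ incident edges. For $X\subseteq L$, $N(X)\subseteq R$ is the set of vertices adjacent to at least one vertex of $X$. For an integer $1\le t\le |L|$ the $t$-th expansion constant of $G$ is $$\alpha_G(t):=\min\left\{\frac{|N(X)|}{|X|}: X\subseteq L,\ 0<|X|\le t\right\}.$$ -}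

module Defs where

open import Data.Bool.Base using (true; false)
open import Data.Fin.Base using (Fin; fromℕ<)
open import Data.Fin.Properties using (any?)
open import Data.Fin.Subset using (Subset; _∈_; ∣_∣; ⁅_⁆; inside; outside)
open import Data.Fin.Subset.Properties using (_∈?_; ∣⁅x⁆∣≡1)
open import Data.Integer.Base using (+_)
open import Data.List.Base using (List; []; _∷_; _++_; map; mapMaybe)
open import Data.List.Extrema using (argmin; f[argmin]≤f[xs])
open import Data.List.Membership.Propositional renaming (_∈_ to _∈ˡ_)
open import Data.List.Membership.Propositional.Properties
  using (∈-++⁺ˡ; ∈-++⁺ʳ; ∈-map⁺)
import Data.List.Relation.Unary.All as All
open import Data.List.Relation.Unary.Any as Any using (here)
open import Data.List.Relation.Unary.Any.Properties using (map⁺; mapMaybe⁺)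
open import Data.Maybe.Base using (Maybe; just)
import Data.Maybe.Base as Maybe
import Data.Maybe.Relation.Unary.Any as MAny
open import Data.Nat.Base using (ℕ; NonZero; >-nonZero; >-nonZero⁻¹; _≤_; _<_)
open import Data.Nat.Properties using (_≤?_; _<?_; ≤-reflexive; ≤-trans)
open import Data.Product.Base using (_,_)
open import Data.Rational.Base as ℚ using (ℚ; _/_)
import Data.Rational.Properties as ℚ
open import Data.Vec.Base using ([]; _∷_; tabulate)
open import Level using (0ℓ)
open import Relation.Binary.Bundles using (DecTotalOrder)
open import Relation.Binary.Core using (REL)
open import Relation.Binary.Definitions using (Decidable)
open import Relation.Binary.PropositionalEquality.Core using (_≡_; refl; sym)
open import Relation.Nullary.Decidable
  using (does; yes; no; dec⇒maybe; _×-dec_)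
open import Relation.Nullary.Negation.Core using (contradiction-irr)

private
  ℚ-order = DecTotalOrder.totalOrder ℚ.≤-decTotalOrder

-- L = Fin n and R = Fin m.  Edges only run between L and R, and a pair of
-- vertices is either adjacent or not, so the graph is simple.
record BipartiteGraph (n m : ℕ) : Set₁ where
  field
    L-nonempty : NonZero n
    R-nonempty : NonZero m
    Adj        : REL (Fin n) (Fin m) 0ℓ
    Adj?       : Decidable Adj

module _ {n m : ℕ} (G : BipartiteGraph n m) where
  open BipartiteGraph G

  neighbours : Fin n → Subset m
  neighbours v = tabulate λ r → does (Adj? v r)

  LeftRegular : ℕ → Set
  LeftRegular d = ∀ v → ∣ neighbours v ∣ ≡ d

  N : Subset n → Subset m
  N X = tabulate λ r → does (any? λ v → (v ∈? X) ×-dec Adj? v r)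

allSubsets : ∀ n → List (Subset n)
allSubsets 0         = [] ∷ []
allSubsets (ℕ.suc n) =
  map (outside ∷_) (allSubsets n) ++ map (inside ∷_) (allSubsets n)

-- The sets over which the minimum is taken: X ⊆ L with 0 < |X| ≤ t.
record TestSet (n t : ℕ) : Set where
  constructor testSet
  field
    set       : Subset n
    .nonempty : 0 < ∣ set ∣
    .bounded  : ∣ set ∣ ≤ t

asTestSet : ∀ {n} t → Subset n → Maybe (TestSet n t)
asTestSet t X = Maybe.map (λ (p , q) → testSet X p q)
  (dec⇒maybe ((0 <? ∣ X ∣) ×-dec (∣ X ∣ ≤? t)))

testSets : ∀ n t → List (TestSet n t)
testSets n t = mapMaybe (asTestSet t) (allSubsets n)

module _ {n m : ℕ} (G : BipartiteGraph n m) where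
  open BipartiteGraph G

  ratio : ∀ {t} → TestSet n t → ℚ
  ratio (testSet X 0<∣X∣ _) = _/_ (+ ∣ N G X ∣) ∣ X ∣ {{>-nonZero 0<∣X∣}}

  singleton : ∀ t → .{{NonZero t}} → TestSet n t
  singleton t = testSet ⁅ v ⁆
    (≤-reflexive (sym (∣⁅x⁆∣≡1 v)))
    (≤-trans (≤-reflexive (∣⁅x⁆∣≡1 v)) (>-nonZero⁻¹ t))
    where v = fromℕ< (>-nonZero⁻¹ n {{L-nonempty}})

  -- A singleton is itself a test set, so using it as the initial value of the
  -- fold does not affect the minimum.  For t > n this is the minimum over all
  -- nonempty subsets of L.
  minimiser : ∀ t → .{{NonZero t}} → TestSet n t
  minimiser t = argmin ℚ-order ratio (singleton t) (testSets n t)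

  α : ∀ t → .{{NonZero t}} → ℚ
  α t = ratio (minimiser t)

∈-allSubsets : ∀ {n} (X : Subset n) → X ∈ˡ allSubsets n
∈-allSubsets []          = here refl
∈-allSubsets (false ∷ X) = ∈-++⁺ˡ (∈-map⁺ _ (∈-allSubsets X))
∈-allSubsets {ℕ.suc n} (true ∷ X) =
  ∈-++⁺ʳ (map (outside ∷_) (allSubsets n)) (∈-map⁺ _ (∈-allSubsets X))

asTestSet-set : ∀ {n t} (X : TestSet n t) →
                MAny.Any (X ≡_) (asTestSet t (TestSet.set X))
asTestSet-set {t = t} (testSet X p q) with 0 <? ∣ X ∣ | ∣ X ∣ ≤? t
... | yes _ | yes _ = MAny.just refl
... | yes _ | no ¬q = contradiction-irr q ¬q
... | no ¬p | _     = contradiction-irr p ¬p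

∈-testSets : ∀ {n t} (X : TestSet n t) → X ∈ˡ testSets n t
∈-testSets {n} {t} X = mapMaybe⁺ (asTestSet t) (allSubsets n)
  (map⁺ (Any.map (λ { refl → asTestSet-set X }) (∈-allSubsets (TestSet.set X))))

α≤ratio : ∀ {n m} (G : BipartiteGraph n m) t → .{{_ : NonZero t}} →
          (X : TestSet n t) → α G t ℚ.≤ ratio G X
α≤ratio {n} G t X = All.lookup
  (f[argmin]≤f[xs] ℚ-order (singleton G t) (testSets n t)) (∈-testSets X)

{-# OPTIONS --safe #-}

-- Since n ≥ m, the right degrees have mean n d / m ≥ d, so some right vertex r
-- has at least d neighbours.  Any t ≤ d of them share the neighbour r, hence
-- have at most 1 + t (d − 1) neighbours altogether.  This gives
-- α(t) ≤ (d − 1) + 1/t for all 1 ≤ t ≤ d, and the first claim is t = 2.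
module Submission where

open import Defs
open import Data.Nat.Base using (ℕ; NonZero; _≤_)
open import Data.Integer.Base using (+_)
open import Data.Rational.Base as ℚ using (_/_; _+_; _-_; ½; 1ℚ)
open import Data.Product.Base using (_×_)
open import Relation.Binary.PropositionalEquality.Core using (_≡_)

open import Data.Bool.Base using (Bool; true; false; if_then_else_)
open import Data.Fin.Base using (Fin; zero; suc)
import Data.Fin.Properties as Fin
open import Data.Fin.Subset using (Subset; _∈_; _⊆_; ∣_∣; ⁅_⁆; ⊥; _∪_; inside; outside)
  renaming (_-_ to _∖_)
open import Data.Fin.Subset.Properties
open import Data.Integer.Base as ℤ using (+≤+)
import Data.Integer.Properties as ℤ
open import Data.Integer.Tactic.RingSolver using (solve-∀)
open import Data.Nat.Base as ℕ using (z≤n; s≤s; _<_; >-nonZero⁻¹)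
import Data.Nat.Properties as ℕ
open import Data.Product.Base using (∃; _,_)
import Data.Rational.Properties as ℚ
open import Data.Rational.Unnormalised.Base as ℚᵘ using (mkℚᵘ; *≡*; *≤*)
import Data.Rational.Unnormalised.Properties as ℚᵘ
open import Data.Sum.Base using (inj₁; inj₂)
open import Data.Vec.Base using ([]; _∷_; here; there; tabulate)
open import Data.Vec.Properties using (lookup∘tabulate; lookup⇒[]=; []=⇒lookup)
open import Function.Base using (_∘_)
open import Relation.Binary.PropositionalEquality.Core using (refl; sym; trans; cong; subst)
open import Relation.Nullary.Decidable using (does; proof; yes; no; dec-true; _×-dec_)
open import Relation.Nullary.Negation.Core using (contradiction)
open import Relation.Nullary.Reflects using (Reflects; invert)
open import Relation.Unary using (Pred; Decidable)
open import Algebra.Properties.CommutativeMonoid.Sum ℕ.+-0-commutativeMonoid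
  using (sum; ∑-comm; sum-cong-≗)

sum-const : ∀ n {k} → sum {n} (λ _ → k) ≡ n ℕ.* k
sum-const ℕ.zero    = refl
sum-const (ℕ.suc n) = cong (_ ℕ.+_) (sum-const n)

-- If the first entry is at most `k`, cancelling `k` from both sides leaves the same strict
-- inequality for the tail, so the search cannot run out of entries.
sum-pigeonhole : ∀ {n k} (f : Fin n → ℕ) → n ℕ.* k < sum f → ∃ λ i → k < f i
sum-pigeonhole {ℕ.suc n} {k} f nk<∑f with k ℕ.<? f zero
... | yes k<f₀ = zero , k<f₀
... | no  k≮f₀ =
  let i , k<fᵢ = sum-pigeonhole (f ∘ suc) (ℕ.+-cancelˡ-< k _ _
        (ℕ.<-≤-trans nk<∑f (ℕ.+-monoˡ-≤ _ (ℕ.≮⇒≥ k≮f₀))))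
  in suc i , k<fᵢ

∣tabulate∣ : ∀ {n} (f : Fin n → Bool) →
             ∣ tabulate f ∣ ≡ sum (λ i → if f i then 1 else 0)
∣tabulate∣ {ℕ.zero}  f = refl
∣tabulate∣ {ℕ.suc n} f with f zero
... | true  = cong ℕ.suc (∣tabulate∣ (f ∘ suc))
... | false = ∣tabulate∣ (f ∘ suc)

-- Both sides count the `true` entries of one matrix, by rows and by columns: with cardinalities
-- written as sums of indicators, the two orders of summation are exchanged. Applied to adjacency,
-- it equates the sums of left and right degrees.
double-count : ∀ {n m} (f : Fin n → Fin m → Bool) →
               sum (λ i → ∣ tabulate (f i) ∣) ≡ sum (λ j → ∣ tabulate (λ i → f i j) ∣)
double-count {n} {m} f =
  trans (sum-cong-≗ {n} (λ i → ∣tabulate∣ (f i)))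
    (trans (∑-comm {n} {m} (λ i j → if f i j then 1 else 0))
      (sym (sum-cong-≗ {m} (λ j → ∣tabulate∣ (λ i → f i j)))))

module _ {n p} {P : Pred (Fin n) p} (P? : Decidable P) where

  ∈-tabulate-does⁻ : ∀ {x} → x ∈ tabulate (does ∘ P?) → P x
  ∈-tabulate-does⁻ {x} x∈ = invert (subst (Reflects (P x))
    (trans (sym (lookup∘tabulate _ x)) ([]=⇒lookup x∈)) (proof (P? x)))

  ∈-tabulate-does⁺ : ∀ {x} → P x → x ∈ tabulate (does ∘ P?)
  ∈-tabulate-does⁺ {x} Px =
    lookup⇒[]= x _ (trans (lookup∘tabulate _ x) (dec-true (P? x) Px))

∣p∪q∣≤∣p∣+∣q∣ : ∀ {n} (p q : Subset n) → ∣ p ∪ q ∣ ≤ ∣ p ∣ ℕ.+ ∣ q ∣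
∣p∪q∣≤∣p∣+∣q∣ []            []            = z≤n
∣p∪q∣≤∣p∣+∣q∣ (outside ∷ p) (outside ∷ q) = ∣p∪q∣≤∣p∣+∣q∣ p q
∣p∪q∣≤∣p∣+∣q∣ (outside ∷ p) (inside ∷ q)  =
  ℕ.≤-trans (s≤s (∣p∪q∣≤∣p∣+∣q∣ p q)) (ℕ.≤-reflexive (sym (ℕ.+-suc ∣ p ∣ ∣ q ∣)))
∣p∪q∣≤∣p∣+∣q∣ (inside ∷ p)  (y ∷ q)       =
  s≤s (ℕ.≤-trans (∣p∪q∣≤∣p∣+∣q∣ p q) (ℕ.+-monoʳ-≤ ∣ p ∣ (∣p∣≤∣x∷p∣ y q)))

subset-of-size : ∀ {n} t (S : Subset n) → t ≤ ∣ S ∣ → ∃ λ X → X ⊆ S × ∣ X ∣ ≡ t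
subset-of-size {n} ℕ.zero S _ = ⊥ , ⊥⊆ , ∣⊥∣≡0 n
subset-of-size (ℕ.suc t) (outside ∷ S) t<∣S∣ =
  let X , X⊆S , ∣X∣≡t = subset-of-size (ℕ.suc t) S t<∣S∣
  in outside ∷ X , out⊆ X⊆S , ∣X∣≡t
subset-of-size (ℕ.suc t) (inside ∷ S) (s≤s t≤∣S∣) =
  let X , X⊆S , ∣X∣≡t = subset-of-size t S t≤∣S∣
  in inside ∷ X , in⊆in X⊆S , cong ℕ.suc ∣X∣≡t

-- The recursion follows that of `∣_∣` on `X`, so the union bound `∣⋃∣≤` is a direct induction with
-- one summand per member.
⋃[_] : ∀ {n m} → Subset n → (Fin n → Subset m) → Subset m
⋃[ []          ] f = ⊥
⋃[ outside ∷ X ] f = ⋃[ X ] (f ∘ suc)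
⋃[ inside ∷ X  ] f = f zero ∪ ⋃[ X ] (f ∘ suc)

∈-⋃⁺ : ∀ {n m} {X : Subset n} (f : Fin n → Subset m) {v x} →
       v ∈ X → x ∈ f v → x ∈ ⋃[ X ] f
∈-⋃⁺ f here x∈ = x∈p∪q⁺ (inj₁ x∈)
∈-⋃⁺ {X = outside ∷ _} f (there v∈X) x∈ = ∈-⋃⁺ (f ∘ suc) v∈X x∈
∈-⋃⁺ {X = inside ∷ _}  f (there v∈X) x∈ =
  x∈p∪q⁺ {p = f zero} (inj₂ (∈-⋃⁺ (f ∘ suc) v∈X x∈))

∣⋃∣≤ : ∀ {n m k} (X : Subset n) (f : Fin n → Subset m) →
       (∀ {v} → v ∈ X → ∣ f v ∣ ≤ k) → ∣ ⋃[ X ] f ∣ ≤ ∣ X ∣ ℕ.* k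
∣⋃∣≤ {m = m} []      f ∣f∣≤k = ℕ.≤-reflexive (∣⊥∣≡0 m)
∣⋃∣≤ (outside ∷ X)   f ∣f∣≤k = ∣⋃∣≤ X (f ∘ suc) (∣f∣≤k ∘ there)
∣⋃∣≤ (inside ∷ X)    f ∣f∣≤k = ℕ.≤-trans (∣p∪q∣≤∣p∣+∣q∣ (f zero) _)
  (ℕ.+-mono-≤ (∣f∣≤k here) (∣⋃∣≤ X (f ∘ suc) (∣f∣≤k ∘ there)))

toℚᵘ-/ : ∀ p q .{{_ : NonZero q}} → ℚ.toℚᵘ (p / q) ℚᵘ.≃ p ℚᵘ./ q
toℚᵘ-/ p (ℕ.suc q) = ℚ.toℚᵘ-fromℚᵘ (mkℚᵘ p q)

-- Divide by `t`: (1 + te)/t = e + 1/t, where e = d - 1 appears as `ℕ.suc e / 1 - 1ℚ` to match the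
-- theorem. The computation is done on unnormalised fractions, where equality is
-- cross-multiplication.
/-≤-from-ℕ : ∀ a e t .{{_ : NonZero t}} → a ≤ 1 ℕ.+ t ℕ.* e →
             + a / t ℚ.≤ (+ ℕ.suc e / 1 - 1ℚ) + + 1 / t
/-≤-from-ℕ a e t@(ℕ.suc _) a≤ = ℚ.toℚᵘ-cancel-≤ (begin
  ℚ.toℚᵘ (+ a / t)
    ≃⟨ toℚᵘ-/ (+ a) t ⟩
  + a ℚᵘ./ t
    ≤⟨ *≤* (ℤ.*-monoʳ-≤-nonNeg (+ t) (+≤+ a≤)) ⟩
  + (1 ℕ.+ t ℕ.* e) ℚᵘ./ t
    -- `ℤ.pos-*` turns the embedded natural product into an integer product, leaving a polynomial
    -- identity in `e` and `t`.
    ≃⟨ *≡* (trans (cong (λ z → (+ 1 ℤ.+ z) ℤ.* (+ 1 ℤ.* + t)) (ℤ.pos-* t e))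
                  (identity (+ e) (+ t))) ⟩
  (+ ℕ.suc e ℚᵘ./ 1 ℚᵘ.- ℚᵘ.1ℚᵘ) ℚᵘ.+ + 1 ℚᵘ./ t
    ≃⟨ ℚᵘ.+-cong (ℚᵘ.+-congˡ _ (toℚᵘ-/ (+ ℕ.suc e) 1)) (toℚᵘ-/ (+ 1) t) ⟨
  (ℚ.toℚᵘ (+ ℕ.suc e / 1) ℚᵘ.- ℚᵘ.1ℚᵘ) ℚᵘ.+ ℚ.toℚᵘ (+ 1 / t)
    ≃⟨ ℚᵘ.+-congˡ _ (ℚ.toℚᵘ-homo-+ (+ ℕ.suc e / 1) (ℚ.- 1ℚ)) ⟨
  ℚ.toℚᵘ (+ ℕ.suc e / 1 - 1ℚ) ℚᵘ.+ ℚ.toℚᵘ (+ 1 / t)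
    ≃⟨ ℚ.toℚᵘ-homo-+ (+ ℕ.suc e / 1 - 1ℚ) (+ 1 / t) ⟨
  ℚ.toℚᵘ ((+ ℕ.suc e / 1 - 1ℚ) + + 1 / t) ∎)
  where
  open ℚᵘ.≤-Reasoning
  identity : ∀ e t → (+ 1 ℤ.+ t ℤ.* e) ℤ.* (+ 1 ℤ.* t) ≡
             (((+ 1 ℤ.+ e) ℤ.* + 1 ℤ.+ ℤ.- + 1 ℤ.* + 1) ℤ.* t ℤ.+ + 1 ℤ.* + 1) ℤ.* t
  identity = solve-∀

module _ {n m : ℕ} (G : BipartiteGraph n m) where
  open BipartiteGraph G

  neighboursᴿ : Fin m → Subset n
  neighboursᴿ r = tabulate λ v → does (Adj? v r)

  ∃-large-neighboursᴿ : ∀ {e} → LeftRegular G (ℕ.suc e) → m ≤ n →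
                        ∃ λ r → ℕ.suc e ≤ ∣ neighboursᴿ r ∣
  ∃-large-neighboursᴿ {e} regular m≤n =
    sum-pigeonhole (λ r → ∣ neighboursᴿ r ∣) (begin-strict
      -- The threshold is `e`, one below the degree, so a right degree above it is at least
      -- `ℕ.suc e`. Strictness comes from `m` being nonzero.
      m ℕ.* e                          <⟨ ℕ.*-monoʳ-< m {{R-nonempty}} (ℕ.n<1+n e) ⟩
      m ℕ.* ℕ.suc e                    ≤⟨ ℕ.*-monoˡ-≤ (ℕ.suc e) m≤n ⟩
      n ℕ.* ℕ.suc e                    ≡⟨ sum-const n ⟨
      sum {n} (λ _ → ℕ.suc e)          ≡⟨ sum-cong-≗ {n} regular ⟨
      sum (λ v → ∣ neighbours G v ∣)   ≡⟨ double-count (λ v r → does (Adj? v r)) ⟩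
      sum (λ r → ∣ neighboursᴿ r ∣)    ∎)
    where open ℕ.≤-Reasoning

  -- Splitting off `r` lets the union bound count it once in total rather than once for each vertex
  -- of `X`.
  N⊆ : ∀ r (X : Subset n) → N G X ⊆ ⁅ r ⁆ ∪ ⋃[ X ] (λ v → neighbours G v ∖ r)
  N⊆ r X {x} x∈N with ∈-tabulate-does⁻ (λ s → Fin.any? λ v → (v ∈? X) ×-dec Adj? v s) x∈N | x Fin.≟ r
  ... | _             | yes refl = x∈p∪q⁺ (inj₁ (x∈⁅x⁆ x))
  ... | v , v∈X , v~x | no x≢r   = x∈p∪q⁺ {p = ⁅ r ⁆} (inj₂ (∈-⋃⁺ _ v∈X
    (x∈p∧x≢y⇒x∈p-y (∈-tabulate-does⁺ (Adj? v) v~x) x≢r)))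

  ∣N∣≤ : ∀ {e} → LeftRegular G (ℕ.suc e) → ∀ r {X} → X ⊆ neighboursᴿ r →
         ∣ N G X ∣ ≤ 1 ℕ.+ ∣ X ∣ ℕ.* e
  ∣N∣≤ {e} regular r {X} X⊆ = begin
    ∣ N G X ∣                      ≤⟨ p⊆q⇒∣p∣≤∣q∣ (N⊆ r X) ⟩
    ∣ ⁅ r ⁆ ∪ ⋃[ X ] f ∣           ≤⟨ ∣p∪q∣≤∣p∣+∣q∣ ⁅ r ⁆ _ ⟩
    ∣ ⁅ r ⁆ ∣ ℕ.+ ∣ ⋃[ X ] f ∣     ≤⟨ ℕ.+-mono-≤ (ℕ.≤-reflexive (∣⁅x⁆∣≡1 r)) (∣⋃∣≤ X f ∣f∣≤e) ⟩
    1 ℕ.+ ∣ X ∣ ℕ.* e              ∎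
    where
    open ℕ.≤-Reasoning
    f : Fin n → Subset m
    f v = neighbours G v ∖ r
    ∣f∣≤e : ∀ {v} → v ∈ X → ∣ f v ∣ ≤ e
    -- Since `v` lies in `neighboursᴿ r`, the vertex `r` is among its `ℕ.suc e` neighbours, so
    -- deleting `r` really lowers the count.
    ∣f∣≤e {v} v∈X = ℕ.s≤s⁻¹ (subst (∣ f v ∣ <_) (regular v)
      (x∈p⇒∣p-x∣<∣p∣ (∈-tabulate-does⁺ (Adj? v)
        (∈-tabulate-does⁻ (λ v → Adj? v r) (X⊆ v∈X)))))

  ratio≤ : ∀ {e t} .{{_ : NonZero t}} (X : TestSet n t) → ∣ TestSet.set X ∣ ≡ t →
           ∣ N G (TestSet.set X) ∣ ≤ 1 ℕ.+ t ℕ.* e →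
           ratio G X ℚ.≤ (+ ℕ.suc e / 1 - 1ℚ) + + 1 / t
  -- Matching `refl` replaces `t` by `∣ X ∣`, the denominator inside `ratio`.
  ratio≤ {e} (testSet X _ _) refl = /-≤-from-ℕ (∣ N G X ∣) e (∣ X ∣)

  α≤ : ∀ d → LeftRegular G d → m ≤ n → ∀ t .{{_ : NonZero t}} → t ≤ d →
       α G t ℚ.≤ (+ d / 1 - 1ℚ) + + 1 / t
  α≤ ℕ.zero    regular m≤n t t≤0 = contradiction (>-nonZero⁻¹ t) (ℕ.≤⇒≯ t≤0)
  α≤ (ℕ.suc e) regular m≤n t t≤d =
    let r , d≤∣Nr∣ = ∃-large-neighboursᴿ regular m≤n
        X , X⊆Nr , ∣X∣≡t = subset-of-size t (neighboursᴿ r) (ℕ.≤-trans t≤d d≤∣Nr∣)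
        0<∣X∣ = subst (0 <_) (sym ∣X∣≡t) (>-nonZero⁻¹ t)
        Xₜ = testSet X 0<∣X∣ (ℕ.≤-reflexive ∣X∣≡t)
    in ℚ.≤-trans (α≤ratio G t Xₜ) (ratio≤ Xₜ ∣X∣≡t
         (subst (λ k → ∣ N G X ∣ ≤ 1 ℕ.+ k ℕ.* e) ∣X∣≡t (∣N∣≤ regular r X⊆Nr)))

lemma1p3 : ∀ {n m : ℕ} (G : BipartiteGraph n m) (d : ℕ) →
    LeftRegular G d → 2 ≤ d → m ≤ n →
    (α G 2 ℚ.≤ (+ d / 1) - ½) ×
    (α G 2 ≡ (+ d / 1) - ½ →
    ∀ (t : ℕ) .{{_ : NonZero t}} → t ≤ d →
    α G t ℚ.≤ ((+ d / 1) - 1ℚ) + (+ 1 / t))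
lemma1p3 G d regular 2≤d m≤n =
  -- At t = 2 the bound is (d - 1) + ½; after reassociation -1 + ½ evaluates to -½.
  subst (α G 2 ℚ.≤_) (ℚ.+-assoc (+ d / 1) (ℚ.- 1ℚ) ½) (α≤ G d regular m≤n 2 2≤d) ,
  λ _ → α≤ G d regular m≤n
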